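{- Let $A$ and $B$ be partial combinatory algebras and let $\gamma : A\to B$ be an applicative morphism. The following statements are equivalent: (i) $\gamma$ is computationally dense; (ii) $\tilde{\gamma}:T(A)\to T(B)$ has a right adjoint in the 2-category of order-pcas; (iii) there is an applicative morphism $\delta : B\to A$ such that $\gamma\delta\leq \mathrm{id}_B$.
   Context: Partial combinatory algebras. A pca is a set $A$ with a partial binary application $(a,b)\mapsto ab$ (associating to the left) for which there exist $\mathsf{k},\mathsf{s}\in A$ such that for all $a,b,c\in A$: $\mathsf{k}ab=a$; $\mathsf{s}ab$ is defined; and whenever $ac(bc)$ is defined, $\mathsf{s}abc$ is defined and equal to it. $t{\downarrow}$ means "$t$ is defined". For $b\in B$, $\beta\subseteq B$: $b\beta{\downarrow}$ means $bx{\downarrow}$ for all $x\in\beta$, and then $b\beta=\{bx\mid x\in\beta\}$. Applicative morphisms of pcas. An applicative morphism $\gamma:A\to B$ assigns to each $a\in A$ a nonempty subset $\gamma(a)\subseteq B$ such that there is $r\in B$ with: whenever $aa'{\downarrow}$, $b\in\gamma(a)$, $b'\in\gamma(a')$, then $rbb'{\downarrow}$ and $rbb'\in\gamma(aa')$. For $\gamma,\delta:A\to B$, $\gamma\leq\delta$ means there is $s\in B$ such that for all $a\in A$, $b\in\gamma(a)$: $sb{\downarrow}$ and $sb\in\delta(a)$. Composition is composition of relations: $(\delta\gamma)(a)=\bigcup_{b\in\gamma(a)}\delta(b)$; $\mathrm{id}_B(b)=\{b\}$. Computational density. $\gamma:A\to B$ is computationally dense if there is $m\in B$ such that for every $b\in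 B$ there is $a\in A$ such that for all $a'\in A$: if $b\gamma(a'){\downarrow}$ then $aa'{\downarrow}$, $m\gamma(aa'){\downarrow}$ and $m\gamma(aa')\subseteq b\gamma(a')$. Order-pcas. An order-pca is a poset $P$ with a partial binary application and elements $\mathsf{k},\mathsf{s}$ such that: if $ab{\downarrow}$, $a'\leq a$, $b'\leq b$ then $a'b'{\downarrow}$ and $a'b'\leq ab$; $\mathsf{k}ab\leq a$; $\mathsf{s}ab{\downarrow}$, and whenever $ac(bc){\downarrow}$, $\mathsf{s}abc{\downarrow}$ and $\mathsf{s}abc\leq ac(bc)$. An applicative morphism of order-pcas $P\to Q$ is a function $f:P\to Q$ such that there is $r\in Q$ with: whenever $aa'{\downarrow}$, $rf(a)f(a'){\downarrow}$ and $rf(a)f(a')\leq f(aa')$; and there is $u\in Q$ with: whenever $a\leq a'$, $uf(a){\downarrow}$ and $uf(a)\leq f(a')$. For such $f,g:P\to Q$, $f\leq g$ means there is $s\in Q$ with $sf(a){\downarrow}$ and $sf(a)\leq g(a)$ for all $a\in P$. This gives a preorder-enriched category (the 2-category of order-pcas); $g:Q\to P$ is right adjoint to $f:P\to Q$ if $\mathrm{id}_P\leq gf$ and $fg\leq\mathrm{id}_Q$. For a pca $A$, $T(A)$ is the order-pca of nonempty subsets of $A$ ordered by inclusion, with $\alpha\beta{\downarrow}$ iff $ab{\downarrow}$ for all $a\in\alpha,b\in\beta$, and then $\alpha\beta=\{ab\mid a\in\alpha,b\in\beta\}$. For an applicative morphism $\gamma:A\to B$ of pcas, $\tilde\gamma:T(A)\to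 T(B)$ is the applicative morphism of order-pcas $\tilde\gamma(\alpha)=\bigcup_{a\in\alpha}\gamma(a)$. -}

module Defs where

open import Data.Product using (Σ; ∃; ∃-syntax; _×_; _,_; proj₁; proj₂)
open import Function.Base using (_∘_; id)
open import Level using (Level; _⊔_; suc)
open import Relation.Binary.Bundles using (Poset)
import Relation.Binary.Construct.On as On
open import Relation.Binary.PropositionalEquality using (_≡_; refl)
open import Relation.Unary using (Pred; _∈_; _⊆_; _≐_; Satisfiable; ｛_｝)
open import Relation.Unary.Relation.Binary.Subset using (⊆-poset)

private
  variable
    c d ℓ ℓ₁ ℓ₂ p : Level

-- Formal applicative expressions with parameters in X.  A partial binary
-- operation on X is given by its graph, and "t is defined with value x"
-- is the evaluation relation t ⇓ x below.

infixl 7 _∙_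

data Term (X : Set c) : Set c where
  ⌜_⌝ : X → Term X
  _∙_ : Term X → Term X → Term X

module Evaluation {X : Set c} (_·_↦_ : X → X → X → Set d) where

  infix 4 _⇓_ _⇓∈_ _↓

  data _⇓_ : Term X → X → Set (c ⊔ d) where
    atom : ∀ {x} → ⌜ x ⌝ ⇓ x
    app  : ∀ {t u x y z} → t ⇓ x → u ⇓ y → x · y ↦ z → t ∙ u ⇓ z

  _↓ : Term X → Set (c ⊔ d)
  t ↓ = ∃[ x ] t ⇓ x

  -- t is defined and its value lies in P.
  _⇓∈_ : Term X → Pred X p → Set (c ⊔ d ⊔ p)
  t ⇓∈ P = ∃[ x ] (t ⇓ x × x ∈ P)

record PCA (ℓ : Level) : Set (suc ℓ) where
  infix 4 _·_↦_
  field
    Carrier    : Set ℓ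
    _·_↦_      : Carrier → Carrier → Carrier → Set ℓ
    functional : ∀ {a b x y} → a · b ↦ x → a · b ↦ y → x ≡ y

  open Evaluation _·_↦_ public

  field
    k s   : Carrier
    k-law : ∀ a b → ⌜ k ⌝ ∙ ⌜ a ⌝ ∙ ⌜ b ⌝ ⇓ a
    s-def : ∀ a b → ⌜ s ⌝ ∙ ⌜ a ⌝ ∙ ⌜ b ⌝ ↓
    s-law : ∀ a b c {x} → ⌜ a ⌝ ∙ ⌜ c ⌝ ∙ (⌜ b ⌝ ∙ ⌜ c ⌝) ⇓ x →
            ⌜ s ⌝ ∙ ⌜ a ⌝ ∙ ⌜ b ⌝ ∙ ⌜ c ⌝ ⇓ x

  infix 4 _[_]↓

  _[_]↓ : Carrier → Pred Carrier ℓ → Set ℓ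
  b [ β ]↓ = ∀ x → x ∈ β → ⌜ b ⌝ ∙ ⌜ x ⌝ ↓

  -- This is the set bβ only when b [ β ]↓.
  _[_] : Carrier → Pred Carrier ℓ → Pred Carrier ℓ
  (b [ β ]) y = ∃[ x ] (x ∈ β × ⌜ b ⌝ ∙ ⌜ x ⌝ ⇓ y)

⋃[_]_ : {X Y : Set ℓ} → (X → Pred Y ℓ) → Pred X ℓ → Pred Y ℓ
(⋃[ γ ] α) y = ∃[ a ] (a ∈ α × y ∈ γ a)

record ApplicativeMorphism (A B : PCA ℓ) : Set (suc ℓ) where
  private
    module A = PCA A
    module B = PCA B
  field
    rel         : A.Carrier → Pred B.Carrier ℓ
    inhabited   : ∀ a → Satisfiable (rel a)
    applicative : ∃[ r ] ∀ {a a′ a″} → a A.· a′ ↦ a″ →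
                  ∀ {b b′} → b ∈ rel a → b′ ∈ rel a′ →
                  ⌜ r ⌝ ∙ ⌜ b ⌝ ∙ ⌜ b′ ⌝ B.⇓∈ rel a″

open ApplicativeMorphism using (rel)

-- The preorder on morphisms A → B and the composition of morphisms depend
-- only on the underlying assignments a ↦ γ(a).
Below : (A B : PCA ℓ) (γ δ : PCA.Carrier A → Pred (PCA.Carrier B) ℓ) → Set ℓ
Below A B γ δ = ∃[ s ] ∀ a {b} → b ∈ γ a → ⌜ s ⌝ ∙ ⌜ b ⌝ B.⇓∈ δ a
  where module B = PCA B

infix 4 Below
syntax Below A B γ δ = γ ≤[ A ⇒ B ] δ

infixr 9 _⊚_

_⊚_ : {X Y Z : Set ℓ} → (Y → Pred Z ℓ) → (X → Pred Y ℓ) → (X → Pred Z ℓ)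
(δ ⊚ γ) a = ⋃[ δ ] (γ a)

module _ {A B : PCA ℓ} (γ : ApplicativeMorphism A B) where
  private
    module A = PCA A
    module B = PCA B

  ComputationallyDense : Set ℓ
  ComputationallyDense =
    ∃[ m ] ∀ b → ∃[ a ] ∀ a′ → b B.[ rel γ a′ ]↓ →
      ∃[ a″ ] ( ⌜ a ⌝ ∙ ⌜ a′ ⌝ A.⇓ a″
              × m B.[ rel γ a″ ]↓
              × m B.[ rel γ a″ ] ⊆ b B.[ rel γ a′ ] )

  HasRightInverseUpTo≤ : Set (suc ℓ)
  HasRightInverseUpTo≤ =
    Σ (ApplicativeMorphism B A) λ δ → (rel γ ⊚ rel δ) ≤[ B ⇒ B ] ｛_｝

record OrderPCA (c ℓ₁ ℓ₂ d : Level) : Set (suc (c ⊔ ℓ₁ ⊔ ℓ₂ ⊔ d)) where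
  field
    poset : Poset c ℓ₁ ℓ₂

  open Poset poset public using (Carrier; _≈_; _≤_)

  infix 4 _·_↦_
  field
    _·_↦_      : Carrier → Carrier → Carrier → Set d
    functional : ∀ {a b x y} → a · b ↦ x → a · b ↦ y → x ≈ y
    respects   : ∀ {a a′ b b′ x x′} → a ≈ a′ → b ≈ b′ → x ≈ x′ →
                 a · b ↦ x → a′ · b′ ↦ x′

  open Evaluation _·_↦_ public

  infix 4 _≼_
  _≼_ : Term Carrier → Carrier → Set (c ⊔ d ⊔ ℓ₂)
  t ≼ x = t ⇓∈ (_≤ x)

  field
    monotone : ∀ {a a′ b b′ x} → a · b ↦ x → a′ ≤ a → b′ ≤ b →
               ⌜ a′ ⌝ ∙ ⌜ b′ ⌝ ≼ x
    k s      : Carrier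
    k-law    : ∀ a b → ⌜ k ⌝ ∙ ⌜ a ⌝ ∙ ⌜ b ⌝ ≼ a
    s-def    : ∀ a b → ⌜ s ⌝ ∙ ⌜ a ⌝ ∙ ⌜ b ⌝ ↓
    s-law    : ∀ a b c {x} → ⌜ a ⌝ ∙ ⌜ c ⌝ ∙ (⌜ b ⌝ ∙ ⌜ c ⌝) ⇓ x →
               ⌜ s ⌝ ∙ ⌜ a ⌝ ∙ ⌜ b ⌝ ∙ ⌜ c ⌝ ≼ x

record OrderMorphism (P Q : OrderPCA c ℓ₁ ℓ₂ d) : Set (c ⊔ ℓ₁ ⊔ ℓ₂ ⊔ d) where
  private
    module P = OrderPCA P
    module Q = OrderPCA Q
  -- The equality of the poset is _≈_ (for T(A), mutual inclusion), so a
  -- function has to respect it; this does not follow from monotone.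
  field
    fun         : P.Carrier → Q.Carrier
    cong        : ∀ {a a′} → a P.≈ a′ → fun a Q.≈ fun a′
    applicative : ∃[ r ] ∀ {a a′ a″} → a P.· a′ ↦ a″ →
                  ⌜ r ⌝ ∙ ⌜ fun a ⌝ ∙ ⌜ fun a′ ⌝ Q.≼ fun a″
    monotone    : ∃[ u ] ∀ {a a′} → a P.≤ a′ →
                  ⌜ u ⌝ ∙ ⌜ fun a ⌝ Q.≼ fun a′

-- As for pcas, the preorder on morphisms depends only on the underlying
-- functions.
OrderBelow : (P Q : OrderPCA c ℓ₁ ℓ₂ d)
             (f g : OrderPCA.Carrier P → OrderPCA.Carrier Q) → Set (c ⊔ ℓ₂ ⊔ d)
OrderBelow P Q f g = ∃[ s ] ∀ a → ⌜ s ⌝ ∙ ⌜ f a ⌝ Q.≼ g a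
  where module Q = OrderPCA Q

infix 4 OrderBelow
syntax OrderBelow P Q f g = f ⊑[ P ⇒ Q ] g

module _ {P Q : OrderPCA c ℓ₁ ℓ₂ d} where
  open OrderMorphism using (fun)

  _IsRightAdjointTo_ : OrderMorphism Q P → OrderMorphism P Q → Set (c ⊔ ℓ₂ ⊔ d)
  g IsRightAdjointTo f = id ⊑[ P ⇒ P ] (fun g ∘ fun f)
                       × (fun f ∘ fun g) ⊑[ Q ⇒ Q ] id

  HasRightAdjoint : OrderMorphism P Q → Set (c ⊔ ℓ₁ ⊔ ℓ₂ ⊔ d)
  HasRightAdjoint f = ∃[ g ] g IsRightAdjointTo f

module PowerPCA (A : PCA ℓ) where
  open PCA A

  InhabitedSubset : Set (suc ℓ)
  InhabitedSubset = Σ (Pred Carrier ℓ) Satisfiable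

  singleton : Carrier → InhabitedSubset
  singleton a = ｛ a ｝ , a , refl

  Products : (α β : Pred Carrier ℓ) → Pred Carrier ℓ
  Products α β x = ∃[ a ] ∃[ b ] (a ∈ α × b ∈ β × a · b ↦ x)

  infix 4 _⊙_↦_

  -- αβ is defined and equal to χ.
  _⊙_↦_ : (α β χ : InhabitedSubset) → Set ℓ
  (α , _) ⊙ (β , _) ↦ (χ , _) =
    (∀ a b → a ∈ α → b ∈ β → ∃[ x ] a · b ↦ x) × χ ≐ Products α β

  private module E = Evaluation _⊙_↦_

  deterministic : ∀ {t x y} → t ⇓ x → t ⇓ y → x ≡ y
  deterministic atom atom = refl
  deterministic (app t⇓ u⇓ ↦x) (app t⇓′ u⇓′ ↦y)
    with refl ← deterministic t⇓ t⇓′ | refl ← deterministic u⇓ u⇓′ =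
    functional ↦x ↦y

  fun↓ : ∀ {u v x} → u ∙ v ⇓ x → u ↓
  fun↓ (app u⇓ _ _) = _ , u⇓

  arg↓ : ∀ {u v x} → u ∙ v ⇓ x → v ↓
  arg↓ (app _ v⇓ _) = _ , v⇓

  -- u ∈ₜ t: the term u arises from t by choosing an element of each subset
  -- occurring in t, independently for different occurrences.
  infix 4 _∈ₜ_

  data _∈ₜ_ : Term Carrier → Term InhabitedSubset → Set (suc ℓ) where
    atom : ∀ {a α} → a ∈ proj₁ α → ⌜ a ⌝ ∈ₜ ⌜ α ⌝
    app  : ∀ {u v t r} → u ∈ₜ t → v ∈ₜ r → u ∙ v ∈ₜ t ∙ r

  selection : ∀ t → ∃[ u ] u ∈ₜ t
  selection ⌜ α , a , a∈ ⌝ = ⌜ a ⌝ , atom a∈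
  selection (t ∙ r) = let _ , p = selection t ; _ , q = selection r in _ , app p q

  -- If t is defined with value χ, then so is every selection from t, with
  -- value in χ.
  sound : ∀ {t u χ} → t E.⇓ χ → u ∈ₜ t → u ⇓∈ proj₁ χ
  sound E.atom (atom a∈) = _ , atom , a∈
  sound (E.app t⇓ r⇓ (def , _ , ⊆χ)) (app p q) =
    let x , u⇓x , x∈ = sound t⇓ p
        y , v⇓y , y∈ = sound r⇓ q
        z , ↦z       = def x y x∈ y∈
    in z , app u⇓x v⇓y ↦z , ⊆χ (x , y , x∈ , y∈ , ↦z)

  -- If every selection from t is defined, then so is t, and its value
  -- consists of values of selections.
  complete : ∀ t → (∀ {u} → u ∈ₜ t → u ↓) →
             ∃[ χ ] (t E.⇓ χ × (∀ {x} → x ∈ proj₁ χ → ∃[ u ] (u ∈ₜ t × u ⇓ x)))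
  complete ⌜ α ⌝ _ = α , E.atom , λ a∈ → _ , atom a∈ , atom
  complete (t ∙ r) def
    with ξ , t⇓ , inv-t ← complete t (λ p →
           let _ , q = selection r ; _ , e = def (app p q) in fun↓ e)
    with υ , r⇓ , inv-r ← complete r (λ q →
           let _ , p = selection t ; _ , e = def (app p q) in arg↓ e) =
    (Products (proj₁ ξ) (proj₁ υ) , inhabited) ,
    E.app t⇓ r⇓ (defined , id , id) ,
    λ (a , b , a∈ , b∈ , ↦x) →
      let u , p , u⇓ = inv-t a∈ ; v , q , v⇓ = inv-r b∈
      in u ∙ v , app p q , app u⇓ v⇓ ↦x
    where
    defined : ∀ a b → a ∈ proj₁ ξ → b ∈ proj₁ υ → ∃[ x ] a · b ↦ x
    defined a b a∈ b∈
      with u , p , u⇓ ← inv-t a∈ | v , q , v⇓ ← inv-r b∈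
      with _ , app u⇓′ v⇓′ ↦x ← def (app p q)
      with refl ← deterministic u⇓ u⇓′ | refl ← deterministic v⇓ v⇓′ = _ , ↦x

    inhabited : Satisfiable (Products (proj₁ ξ) (proj₁ υ))
    inhabited =
      let a , a∈ = proj₂ ξ
          b , b∈ = proj₂ υ
          x , ↦x = defined a b a∈ b∈
      in x , a , b , a∈ , b∈ , ↦x

  ≼-intro : ∀ {t} {ξ : InhabitedSubset} → (∀ {u} → u ∈ₜ t → u ⇓∈ proj₁ ξ) →
            t E.⇓∈ λ χ → proj₁ χ ⊆ proj₁ ξ
  ≼-intro {t} {ξ} h
    with χ , t⇓ , inv ← complete t (λ p → let x , u⇓ , _ = h p in x , u⇓) =
    χ , t⇓ , λ x∈ → let u , p , u⇓ = inv x∈ in below u⇓ (h p)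
    where
    below : ∀ {u x} → u ⇓ x → u ⇓∈ proj₁ ξ → x ∈ proj₁ ξ
    below u⇓ (y , u⇓′ , y∈) with refl ← deterministic u⇓ u⇓′ = y∈

  T : OrderPCA (suc ℓ) ℓ ℓ ℓ
  T = record
    { poset      = On.poset (⊆-poset Carrier ℓ) proj₁
    ; _·_↦_      = _⊙_↦_
    ; functional = λ (_ , x⊆ , ⊆x) (_ , y⊆ , ⊆y) →
        (λ p → ⊆y (x⊆ p)) , (λ p → ⊆x (y⊆ p))
    ; respects   = λ (α⊆ , α⊇) (β⊆ , β⊇) (χ⊆ , χ⊇) (def , ⊆αβ , ⊇αβ) →
        (λ a b a∈ b∈ → def a b (α⊇ a∈) (β⊇ b∈)) ,
        (λ x∈ → let a , b , a∈ , b∈ , ↦x = ⊆αβ (χ⊇ x∈)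
                in a , b , α⊆ a∈ , β⊆ b∈ , ↦x) ,
        (λ (a , b , a∈ , b∈ , ↦x) → χ⊆ (⊇αβ (a , b , α⊇ a∈ , β⊇ b∈ , ↦x)))
    ; monotone   = λ {α} {α′} {β} {β′} {χ} αβ↦χ α′⊆α β′⊆β →
        ≼-intro {ξ = χ} λ { (app (atom a∈) (atom b∈)) →
          sound {⌜ α ⌝ ∙ ⌜ β ⌝} {χ = χ} (E.app E.atom E.atom αβ↦χ)
                (app (atom (α′⊆α a∈)) (atom (β′⊆β b∈))) }
    ; k          = singleton k
    ; s          = singleton s
    ; k-law      = λ α β → ≼-intro {ξ = α} λ
        { (app (app (atom refl) (atom a∈)) (atom b∈)) → _ , k-law _ _ , a∈ }
    ; s-def      = λ α β →
        let χ , ⇓χ , _ = complete (⌜ singleton s ⌝ ∙ ⌜ α ⌝ ∙ ⌜ β ⌝) λ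
              { (app (app (atom refl) (atom _)) (atom _)) → s-def _ _ }
        in χ , ⇓χ
    ; s-law      = λ α β γ {ξ} ⇓ξ → ≼-intro {ξ = ξ} λ
        { (app (app (app (atom refl) (atom a∈)) (atom b∈)) (atom c∈)) →
          let x , e , x∈ = sound ⇓ξ (app (app (atom a∈) (atom c∈))
                                         (app (atom b∈) (atom c∈)))
          in x , s-law _ _ _ e , x∈ }
    }

open PowerPCA public using (T)

-- The morphism T(A) → T(B), α ↦ ⋃_{a ∈ α} γ(a).
tilde : {A B : PCA ℓ} → ApplicativeMorphism A B → OrderMorphism (T A) (T B)
tilde {A = A} {B = B} γ = record
  { fun         = fun
  ; cong        = λ (⊆ , ⊇) → (λ (a , a∈ , b∈) → a , ⊆ a∈ , b∈)
                            , (λ (a , a∈ , b∈) → a , ⊇ a∈ , b∈)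
  ; applicative =
      let r , track = ApplicativeMorphism.applicative γ
      in singleton r , λ {α} {α′} {α″} (def , _ , ⊆α″) → ≼-intro {ξ = fun α″} λ
        { (app (app (atom refl) (atom (a , a∈ , b∈))) (atom (a′ , a′∈ , b′∈))) →
          let a″ , ↦a″    = def a a′ a∈ a′∈
              x , e , x∈ = track ↦a″ b∈ b′∈
          in x , e , a″ , ⊆α″ (a , a′ , a∈ , a′∈ , ↦a″) , x∈ }
  ; monotone    =
      let i , identity = I
      in singleton i , λ {α} {α′} α⊆α′ → ≼-intro {ξ = fun α′} λ
        { (app (atom refl) (atom (a , a∈ , b∈))) →
          _ , identity _ , a , α⊆α′ a∈ , b∈ }
  }
  where
  open PCA B
  open PowerPCA B

  fun : PowerPCA.InhabitedSubset A → InhabitedSubset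
  fun (α , a , a∈) = ⋃[ rel γ ] α ,
    let b , b∈ = ApplicativeMorphism.inhabited γ a in b , a , a∈ , b∈

  kb-kb : ∀ b → ⌜ k ⌝ ∙ ⌜ b ⌝ ∙ (⌜ k ⌝ ∙ ⌜ b ⌝) ⇓ b
  kb-kb b
    with app {x = y} kb⇓y _ _ ← k-law b b
    with app kb⇓y′ atom y·y↦b ← k-law b y = app kb⇓y′ kb⇓y y·y↦b

  I : ∃[ i ] ∀ b → ⌜ i ⌝ ∙ ⌜ b ⌝ ⇓ b
  I = let i , skk⇓i = s-def k k in i , identity skk⇓i
    where
    identity : ∀ {i} → ⌜ s ⌝ ∙ ⌜ k ⌝ ∙ ⌜ k ⌝ ⇓ i → ∀ b → ⌜ i ⌝ ∙ ⌜ b ⌝ ⇓ b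
    identity skk⇓i b
      with app skk⇓i′ atom i·b↦b ← s-law k k b (kb-kb b)
      with refl ← deterministic skk⇓i skk⇓i′ = app atom atom i·b↦b

{-# OPTIONS --safe #-}

-- If m witnesses density of γ, the right adjoint of γ̃ sends β to the set of
-- codes c with mγ(c) ⊆ β: density yields a code for any b ∈ β (from the constant
-- function with value b), the unit (from the identity function) and a realizer for
-- application (from decoding and applying both components of a pair).
-- A right adjoint restricted to singletons is a δ as in (iii).  Conversely,
-- given δ with γδ ≤ id realized by t, an a witnessing density for b is
-- a′ ↦ ⟨c , a′⟩ with c ∈ δ(b), and m computes b from γ(c) by t and applies it
-- to the element of γ(a′).

module Submission where

open import Defs
open import Level using (Level)
open import Data.Fin.Base using (Fin; zero; suc)
open import Data.Nat.Base using (ℕ; suc)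
open import Data.Product using (∃-syntax; _×_; _,_; proj₁; proj₂)
open import Data.Vec.Base using (Vec; []; _∷_; lookup)
open import Function.Bundles using (_⇔_; mk⇔)
open import Function.Base using (_∘_)
open import Relation.Binary.PropositionalEquality using (refl)
open import Relation.Unary using (Pred; _∈_; _⊆_)

private
  variable
    ℓ : Level
    n : ℕ

-- Combinatory completeness and pairing in a pca.

infixl 7 _∙_

data Poly (X : Set ℓ) (n : ℕ) : Set ℓ where
  ⌜_⌝ : X → Poly X n
  var : Fin n → Poly X n
  _∙_ : Poly X n → Poly X n → Poly X n

pattern #0 = var zero
pattern #1 = var (suc zero)
pattern #2 = var (suc (suc zero))

module CombinatoryCompleteness (A : PCA ℓ) where
  open PCA A
  open PowerPCA A using (deterministic)

  ⟦_⟧ : Poly Carrier n → Vec Carrier n → Term Carrier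
  ⟦ ⌜ a ⌝ ⟧ ρ = ⌜ a ⌝
  ⟦ var i ⟧ ρ = ⌜ lookup ρ i ⌝
  ⟦ t ∙ u ⟧ ρ = ⟦ t ⟧ ρ ∙ ⟦ u ⟧ ρ

  -- Bracket abstraction. Every application goes through `s`, even one free of the bound variable:
  -- `k` applied to it would be undefined whenever it is, whereas `s-def` makes every abstraction
  -- defined (`ƛ↓`).
  ƛ : Poly Carrier (suc n) → Poly Carrier n
  ƛ ⌜ a ⌝         = ⌜ k ⌝ ∙ ⌜ a ⌝
  ƛ #0            = ⌜ s ⌝ ∙ ⌜ k ⌝ ∙ ⌜ k ⌝
  ƛ (var (suc i)) = ⌜ k ⌝ ∙ var i
  ƛ (t ∙ u)       = ⌜ s ⌝ ∙ ƛ t ∙ ƛ u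

  k↓ : ∀ a → ⌜ k ⌝ ∙ ⌜ a ⌝ ↓
  k↓ a with app ka⇓ _ _ ← k-law a a = _ , ka⇓

  app⇓ : ∀ {t u x y z} → t ⇓ x → u ⇓ y → ⌜ x ⌝ ∙ ⌜ y ⌝ ⇓ z → t ∙ u ⇓ z
  app⇓ t⇓ u⇓ (app atom atom ↦z) = app t⇓ u⇓ ↦z

  app⇓⁻ : ∀ {t u x y z} → t ⇓ x → u ⇓ y → t ∙ u ⇓ z → ⌜ x ⌝ ∙ ⌜ y ⌝ ⇓ z
  app⇓⁻ t⇓ u⇓ (app t⇓′ u⇓′ ↦z)
    with refl ← deterministic t⇓ t⇓′ | refl ← deterministic u⇓ u⇓′ =
    app atom atom ↦z

  value∈ : ∀ {t x} {P : Pred Carrier ℓ} → t ⇓ x → t ⇓∈ P → x ∈ P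
  value∈ ⇓x (_ , ⇓x′ , x′∈) with refl ← deterministic ⇓x ⇓x′ = x′∈

  s-subst : ∀ {t u x y z} → t ⇓ x → u ⇓ y →
            ⌜ s ⌝ ∙ ⌜ x ⌝ ∙ ⌜ y ⌝ ⇓ z → ⌜ s ⌝ ∙ t ∙ u ⇓ z
  s-subst t⇓ u⇓ (app (app atom atom ↦sx) atom ↦z) =
    app (app atom t⇓ ↦sx) u⇓ ↦z

  ƛ↓ : (t : Poly Carrier (suc n)) (ρ : Vec Carrier n) → ⟦ ƛ t ⟧ ρ ↓
  ƛ↓ ⌜ a ⌝         ρ = k↓ a
  ƛ↓ #0            ρ = s-def k k
  ƛ↓ (var (suc i)) ρ = k↓ (lookup ρ i)
  ƛ↓ (t ∙ u)       ρ =
    let f , t⇓ = ƛ↓ t ρ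
        g , u⇓ = ƛ↓ u ρ
        h , ⇓h = s-def f g
    in h , s-subst t⇓ u⇓ ⇓h

  β-law : (t : Poly Carrier (suc n)) (ρ : Vec Carrier n) (a : Carrier) →
          ∀ {x} → ⟦ t ⟧ (a ∷ ρ) ⇓ x → ⟦ ƛ t ⟧ ρ ∙ ⌜ a ⌝ ⇓ x
  β-law ⌜ b ⌝         ρ a atom = k-law b a
  β-law (var (suc i)) ρ a atom = k-law (lookup ρ i) a
  β-law #0            ρ a atom =
    let ka , ka⇓ = k↓ a
    in s-law k k a (app⇓ ka⇓ ka⇓ (app⇓⁻ ka⇓ atom (k-law a ka)))
  β-law (t ∙ u) ρ a (app t⇓ u⇓ ↦z) =
    let f , f⇓ = ƛ↓ t ρ
        g , g⇓ = ƛ↓ u ρ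
        h , h⇓ = s-def f g
    in app⇓ (s-subst f⇓ g⇓ h⇓) atom
         (app⇓⁻ h⇓ atom
           (s-law f g a (app (app⇓⁻ f⇓ atom (β-law t ρ a t⇓))
                             (app⇓⁻ g⇓ atom (β-law u ρ a u⇓)) ↦z)))

  abstract₁ : (t : Poly Carrier 1) →
              ∃[ f ] ∀ a {x} → ⟦ t ⟧ (a ∷ []) ⇓ x → ⌜ f ⌝ ∙ ⌜ a ⌝ ⇓ x
  abstract₁ t =
    let f , f⇓ = ƛ↓ t []
    in f , λ a t⇓ → app⇓⁻ f⇓ atom (β-law t [] a t⇓)

  -- The inner abstraction binds the second argument, so `#0` stands for `b` and `#1` for `a`.
  abstract₂ : (t : Poly Carrier 2) →
              ∃[ f ] ∀ a b {x} → ⟦ t ⟧ (b ∷ a ∷ []) ⇓ x →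
                     ⌜ f ⌝ ∙ ⌜ a ⌝ ∙ ⌜ b ⌝ ⇓ x
  abstract₂ t =
    let f , f-law = abstract₁ (ƛ t)
    in f , λ a b t⇓ →
         let g , g⇓ = ƛ↓ t (a ∷ [])
         in app⇓ (f-law a g⇓) atom (app⇓⁻ g⇓ atom (β-law t (a ∷ []) b t⇓))

  identity : ∃[ i ] ∀ a → ⌜ i ⌝ ∙ ⌜ a ⌝ ⇓ a
  identity = let i , i-law = abstract₁ #0 in i , λ a → i-law a atom

  constant : ∀ b → ∃[ f ] ∀ a → ⌜ f ⌝ ∙ ⌜ a ⌝ ⇓ b
  constant b = let f , f-law = abstract₁ ⌜ b ⌝ in f , λ a → f-law a atom

  record IsPair (p₁ p₂ a b c : Carrier) : Set ℓ where
    field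
      fst : ⌜ p₁ ⌝ ∙ ⌜ c ⌝ ⇓ a
      snd : ⌜ p₂ ⌝ ∙ ⌜ c ⌝ ⇓ b

  -- Church pairs: the pair of `a` and `b` is the function sending z to z a b, and each projection
  -- feeds it a selector.
  pairing : ∃[ p ] ∃[ p₁ ] ∃[ p₂ ] ∀ a b →
            ⌜ p ⌝ ∙ ⌜ a ⌝ ∙ ⌜ b ⌝ ⇓∈ IsPair p₁ p₂ a b
  pairing =
    let p  , p-law  = abstract₂ (ƛ pair)
        π₁ , π₁-law = abstract₂ #1
        π₂ , π₂-law = abstract₂ #0
        p₁ , p₁-law = abstract₁ (#0 ∙ ⌜ π₁ ⌝)
        p₂ , p₂-law = abstract₁ (#0 ∙ ⌜ π₂ ⌝)
    in p , p₁ , p₂ , λ a b →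
         let c , c⇓ = ƛ↓ pair (b ∷ a ∷ [])
             project : ∀ {π x} → ⌜ π ⌝ ∙ ⌜ a ⌝ ∙ ⌜ b ⌝ ⇓ x → ⌜ c ⌝ ∙ ⌜ π ⌝ ⇓ x
             project π⇓ = app⇓⁻ c⇓ atom (β-law pair (b ∷ a ∷ []) _ π⇓)
         in c , p-law a b c⇓ , record
              { fst = p₁-law c (project (π₁-law a b atom))
              ; snd = p₂-law c (project (π₂-law a b atom)) }
    where
    pair : Poly Carrier 3
    -- Here `#0` is the selector, `#2` the first component and `#1` the second.
    pair = #0 ∙ #2 ∙ #1

-- Realizers in `B` for computations in `A`.

module _ {A B : PCA ℓ} (γ : ApplicativeMorphism A B) where
  private
    module A where
      open PCA A public
      open CombinatoryCompleteness A public
    module B where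
      open PCA B public
      open CombinatoryCompleteness B public
  open ApplicativeMorphism γ using (rel; inhabited; applicative)

  -- Fix some `b ∈ rel a` as the first argument of the realizer of `γ`.
  track : ∀ a → ∃[ e ] ∀ {a′ a″} → ⌜ a ⌝ ∙ ⌜ a′ ⌝ A.⇓ a″ →
          ∀ {y} → y ∈ rel a′ → ⌜ e ⌝ ∙ ⌜ y ⌝ B.⇓∈ rel a″
  track a =
    let r , r-tracks = applicative
        b , b∈       = inhabited a
        e , e-law    = B.abstract₁ (⌜ r ⌝ ∙ ⌜ b ⌝ ∙ #0)
    in e , λ { (A.app A.atom A.atom ↦a″) y∈ →
         let x , ⇓x , x∈ = r-tracks ↦a″ b∈ y∈
         in x , e-law _ ⇓x , x∈ }

  -- Density speaks of functions of one argument. Pairing in `A` and tracking the projections lets a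
  -- single element of `B` carry two arguments.
  uncurry-track : ∃[ p ] ∃[ e₁ ] ∃[ e₂ ] ∀ a a′ →
    ⌜ p ⌝ ∙ ⌜ a ⌝ ∙ ⌜ a′ ⌝ A.⇓∈ λ c → ∀ {y} → y ∈ rel c →
      ⌜ e₁ ⌝ ∙ ⌜ y ⌝ B.⇓∈ rel a × ⌜ e₂ ⌝ ∙ ⌜ y ⌝ B.⇓∈ rel a′
  uncurry-track =
    let p , p₁ , p₂ , p-law = A.pairing
        e₁ , track₁ = track p₁
        e₂ , track₂ = track p₂
    in p , e₁ , e₂ , λ a a′ →
         let c , c⇓ , c-pair = p-law a a′
         in c , c⇓ , λ y∈ → track₁ (A.IsPair.fst c-pair) y∈
                          , track₂ (A.IsPair.snd c-pair) y∈

  -- From density to a right adjoint.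

  Code : B.Carrier → Pred B.Carrier ℓ → Pred A.Carrier ℓ
  Code m β c = ∀ {x} → x ∈ rel c → ⌜ m ⌝ ∙ ⌜ x ⌝ B.⇓∈ β

  -- Density in the form used below: `a` turns codes relative to `b` into codes relative to `m`, for
  -- all `β` at once, because the values of `m` are among those of `b`.
  dense⇒code : ((m , _) : ComputationallyDense γ) →
    ∀ b → ∃[ a ] ∀ a′ {β : Pred B.Carrier ℓ} → Code b β a′ →
          ⌜ a ⌝ ∙ ⌜ a′ ⌝ A.⇓∈ Code m β
  dense⇒code (m , dense) b =
    let a , a-law = dense b
    in a , λ a′ {β} b∈β →
      let a″ , a″⇓ , m↓ , m⊆b = a-law a′ λ _ x∈ → let y , ⇓y , _ = b∈β x∈ in y , ⇓y
      in a″ , a″⇓ , λ {x} x∈ →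
        let y , ⇓y = m↓ x x∈
            x′ , x′∈ , ⇓y′ = m⊆b (x , x∈ , ⇓y)
        in y , ⇓y , B.value∈ ⇓y′ (b∈β x′∈)

  dense⇒rightAdjoint : ComputationallyDense γ → HasRightAdjoint (tilde γ)
  dense⇒rightAdjoint dense@(m , _) = g , unit , counit
    where
    module TA = PowerPCA A
    module TB = PowerPCA B

    code : ∀ b → ∃[ a ] ∀ a′ {β : Pred B.Carrier ℓ} → Code b β a′ →
           ⌜ a ⌝ ∙ ⌜ a′ ⌝ A.⇓∈ Code m β
    code = dense⇒code dense

    code-mono : ∀ {β β′ : Pred B.Carrier ℓ} → β ⊆ β′ → Code m β ⊆ Code m β′
    code-mono β⊆ c∈ x∈ = let y , ⇓y , y∈ = c∈ x∈ in y , ⇓y , β⊆ y∈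

    codes : TB.InhabitedSubset → TA.InhabitedSubset
    codes (β , b , b∈) = Code m β ,
      let f , f-law = B.constant b
          a , a-law = code f
          -- The argument `A.k` is arbitrary, as `f` is constant.
          c , _ , c∈ = a-law A.k λ _ → b , f-law _ , b∈
      in c , c∈

    applyCodes : ∃[ r ] ∀ {β β′ β″} → β TB.⊙ β′ ↦ β″ → ∀ {c c′} →
      c ∈ Code m (proj₁ β) → c′ ∈ Code m (proj₁ β′) →
      ⌜ r ⌝ ∙ ⌜ c ⌝ ∙ ⌜ c′ ⌝ A.⇓∈ Code m (proj₁ β″)
    applyCodes =
      let p , e₁ , e₂ , p-law = uncurry-track
          -- Relative to `f`, the pair of `c` and `c′` is a code of the product set; `code f` makes
          -- it one relative to `m`.
          f , f-law = B.abstract₁ ((⌜ m ⌝ ∙ (⌜ e₁ ⌝ ∙ #0)) ∙ (⌜ m ⌝ ∙ (⌜ e₂ ⌝ ∙ #0)))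
          a , a-law = code f
          r , r-law = A.abstract₂ (⌜ a ⌝ ∙ (⌜ p ⌝ ∙ #1 ∙ #0))
      in r , λ (def , _ , ⊆β″) {c} {c′} c∈ c′∈ →
        let d , d⇓ , decode = p-law c c′
            z , z⇓ , z∈ = a-law d λ y∈ →
              let (x  , x⇓  , x∈) , (x′ , x′⇓ , x′∈) = decode y∈
                  b  , b⇓  , b∈  = c∈ x∈
                  b′ , b′⇓ , b′∈ = c′∈ x′∈
                  b″ , ↦b″       = def b b′ b∈ b′∈
              in b″ , f-law _ (B.app (B.app⇓ B.atom x⇓ b⇓) (B.app⇓ B.atom x′⇓ b′⇓) ↦b″)
                    , ⊆β″ (b , b′ , b∈ , b′∈ , ↦b″)
        in z , r-law c c′ (A.app⇓ A.atom d⇓ z⇓) , z∈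

    g : OrderMorphism (T B) (T A)
    g = record
      { fun         = codes
      ; cong        = λ (⊆ , ⊇) → code-mono ⊆ , code-mono ⊇
      ; applicative =
          let r , r-law = applyCodes
          in TA.singleton r , λ {β} {β′} {β″} β·β′ → TA.≼-intro {ξ = codes β″} λ
            { (TA.app (TA.app (TA.atom refl) (TA.atom c∈)) (TA.atom c′∈)) →
              r-law {β} {β′} {β″} β·β′ c∈ c′∈ }
      ; monotone    =
          let i , i-law = A.identity
          in TA.singleton i , λ {β} {β′} β⊆ → TA.≼-intro {ξ = codes β′} λ
            { (TA.app (TA.atom refl) (TA.atom c∈)) → _ , i-law _ , code-mono β⊆ c∈ }
      }

    γ̃ : TA.InhabitedSubset → TB.InhabitedSubset
    γ̃ = OrderMorphism.fun (tilde γ)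

    unit : (λ α → α) ⊑[ T A ⇒ T A ] (codes ∘ γ̃)
    unit =
      let i , i-law = B.identity
          a , a-law = code i
      in TA.singleton a , λ α → TA.≼-intro {ξ = codes (γ̃ α)} λ
        { (TA.app (TA.atom refl) (TA.atom {a′} a′∈)) →
          -- Relative to the identity `i`, each `a′ ∈ α` is a code of `γ̃ α`, which contains
          -- `rel a′`.
          a-law a′ λ x∈ → _ , i-law _ , a′ , a′∈ , x∈ }

    counit : (γ̃ ∘ codes) ⊑[ T B ⇒ T B ] (λ β → β)
    counit = TB.singleton m , λ β → TB.≼-intro {ξ = β} λ
      { (TB.app (TB.atom refl) (TB.atom (_ , c∈ , x∈))) → c∈ x∈ }

  -- From a right adjoint to a right inverse up to the preorder.

  rightAdjoint⇒rightInverse : HasRightAdjoint (tilde γ) → HasRightInverseUpTo≤ γ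
  -- A realizer in `T B` is an inhabited set; by `TB.sound` any element `t` of it realizes the
  -- inequality in `B`.
  rightAdjoint⇒rightInverse (g , _ , (_ , t , t∈) , counit) = δ , t , λ b x∈ →
    let _ , e , ⊆b  = counit (TB.singleton b)
        y , ⇓y , y∈ = TB.sound e (TB.app (TB.atom t∈) (TB.atom x∈))
    in y , ⇓y , ⊆b y∈
    where
    module TA = PowerPCA A
    module TB = PowerPCA B
    module g = OrderMorphism g

    singleton-⊙ : ∀ {b b′ b″} → b B.· b′ ↦ b″ →
                  TB.singleton b TB.⊙ TB.singleton b′ ↦ TB.singleton b″
    singleton-⊙ ↦b″ =
      (λ { _ _ refl refl → _ , ↦b″ }) ,
      (λ { refl → _ , _ , refl , refl , ↦b″ }) ,
      (λ { (_ , _ , refl , refl , ↦x) → B.functional ↦b″ ↦x })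

    δ : ApplicativeMorphism B A
    δ = record
      { rel         = λ b → proj₁ (g.fun (TB.singleton b))
      ; inhabited   = λ b → proj₂ (g.fun (TB.singleton b))
      ; applicative =
          let (_ , r , r∈) , g-tracks = g.applicative
          in r , λ ↦b″ c∈ c′∈ →
            let _ , e , ⊆b″ = g-tracks (singleton-⊙ ↦b″)
                x , ⇓x , x∈ = TA.sound e
                  (TA.app (TA.app (TA.atom r∈) (TA.atom c∈)) (TA.atom c′∈))
            in x , ⇓x , ⊆b″ x∈
      }

  -- From a right inverse to density.

  rightInverse⇒dense : HasRightInverseUpTo≤ γ → ComputationallyDense γ
  rightInverse⇒dense (δ , t , t-law) =
    let p , e₁ , e₂ , p-law = uncurry-track
        -- `b` enters only through the code `c` stored in the pair, so one `m` serves for all `b`.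
        m , m-law = B.abstract₁ ((⌜ t ⌝ ∙ (⌜ e₁ ⌝ ∙ #0)) ∙ (⌜ e₂ ⌝ ∙ #0))
    in m , λ b →
      let c , c∈    = ApplicativeMorphism.inhabited δ b
          a , a-law = A.abstract₁ (⌜ p ⌝ ∙ ⌜ c ⌝ ∙ #0)
      in a , λ a′ b↓ →
        let d , d⇓ , decode = p-law c a′

            run : ∀ {y} → y ∈ rel d → ⌜ m ⌝ ∙ ⌜ y ⌝ B.⇓∈ b B.[ rel a′ ]
            run y∈ =
              let (x , x⇓ , x∈) , (x′ , x′⇓ , x′∈) = decode y∈
                  z , ⇓z = b↓ x′ x′∈
              in z , m-law _ (B.app⇓ (B.app⇓ B.atom x⇓ (computes-b c∈ x∈)) x′⇓ ⇓z)
                   , x′ , x′∈ , ⇓z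
        in d , a-law a′ d⇓
             , (λ y y∈ → let z , ⇓z , _ = run y∈ in z , ⇓z)
             -- Application is single-valued, so the given value of `m` at `y` is the one found by
             -- `run`.
             , λ (y , y∈ , ⇓z) → B.value∈ ⇓z (run y∈)
    where
    computes-b : ∀ {b c x} → c ∈ ApplicativeMorphism.rel δ b → x ∈ rel c →
                 ⌜ t ⌝ ∙ ⌜ x ⌝ B.⇓ b
    computes-b c∈ x∈ with _ , ⇓b , refl ← t-law _ (_ , c∈ , x∈) = ⇓b

corollary2p3 : ∀ {ℓ : Level} (A B : PCA ℓ) (γ : ApplicativeMorphism A B) →
    (ComputationallyDense γ ⇔ HasRightAdjoint (tilde γ))
    × (HasRightAdjoint (tilde γ) ⇔ HasRightInverseUpTo≤ γ)
corollary2p3 A B γ =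
  mk⇔ (dense⇒rightAdjoint γ) (rightInverse⇒dense γ ∘ rightAdjoint⇒rightInverse γ) ,
  mk⇔ (rightAdjoint⇒rightInverse γ) (dense⇒rightAdjoint γ ∘ rightInverse⇒dense γ)
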